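{- For every integer $n\geq 3$, the Albertson index of the caterpillar tree $C(n,3)$ is $$\operatorname{irr}(C(n,3)) = 12n-4.$$
   Context: All graphs are finite, simple and undirected. For a graph $G$ with edge set $E(G)$, $d_G(v)$ denotes the degree of the vertex $v$. The Albertson index of $G$ is $\operatorname{irr}(G)=\sum_{uv\in E(G)}|d_G(u)-d_G(v)|$. For positive integers $n,m$, the caterpillar tree $C(n,m)$ is the tree consisting of a path $x_1x_2\cdots x_n$ on $n$ vertices (the main vertices) together with, for each $i=1,\dots,n$, exactly $m$ pendent vertices (leaves) adjacent to $x_i$, these leaves being distinct for distinct $i$. In particular, in $C(n,3)$ each of the $n$ path vertices has exactly three pendent vertices attached. -}

module Defs where

open import Data.Nat using (ℕ; suc; ∣_-_∣)
open import Data.Nat.Properties using (1+n≢n) renaming (_≟_ to _≟ℕ_)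
open import Data.Fin using (Fin; toℕ; _≟_)
open import Data.List
  using (List; []; _∷_; _++_; map; filter; length; allFin; cartesianProductWith)
open import Data.Nat.ListAction using (sum)
open import Data.List.Membership.Propositional using (_∈_)
open import Data.List.Membership.Propositional.Properties
  using (∈-++⁺ˡ; ∈-++⁺ʳ; ∈-map⁺; ∈-map⁻; ∈-allFin; ∈-cartesianProductWith⁺; ∈-cartesianProductWith⁻)
open import Data.List.Relation.Binary.Disjoint.Propositional using (Disjoint)
open import Data.List.Relation.Unary.Unique.Propositional using (Unique)
open import Data.List.Relation.Unary.Unique.Propositional.Properties
  using (++⁺; map⁺; allFin⁺; cartesianProductWith⁺)
open import Data.Product using (_×_; _,_; uncurry)
open import Relation.Binary.Core using (Rel)
open import Relation.Binary.Definitions using (Symmetric; Irreflexive; Decidable)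
open import Relation.Binary.Construct.Closure.Symmetric as Sym using (SymClosure; fwd; bwd)
open import Relation.Binary.PropositionalEquality using (_≡_; refl)
open import Relation.Nullary.Decidable using (yes; no; map′)
open import Level using (0ℓ)

-- A finite simple undirected graph.  Finiteness of the vertex type is
-- witnessed by a list containing every vertex exactly once.
record Graph : Set₁ where
  field
    Vertex   : Set
    vertices : List Vertex
    unique   : Unique vertices
    complete : ∀ v → v ∈ vertices
    Adj      : Rel Vertex 0ℓ
    sym      : Symmetric Adj
    irrefl   : Irreflexive _≡_ Adj
    adj?     : Decidable Adj

module _ (G : Graph) where
  open Graph G

  degree : Vertex → ℕ
  degree v = length (filter (adj? v) vertices)

  -- An edge uv with u before v in the list is recorded once, as (u , v).
  edgesWithin : List Vertex → List (Vertex × Vertex)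
  edgesWithin []       = []
  edgesWithin (u ∷ vs) = map (u ,_) (filter (adj? u) vs) ++ edgesWithin vs

  edges : List (Vertex × Vertex)
  edges = edgesWithin vertices

  -- The Albertson index; ∣_-_∣ is the absolute difference on ℕ.
  irr : ℕ
  irr = sum (map (uncurry λ u v → ∣ degree u - degree v ∣) edges)

data CaterpillarVertex (n m : ℕ) : Set where
  main : Fin n → CaterpillarVertex n m
  leaf : Fin n → Fin m → CaterpillarVertex n m

-- The edges of C(n,m), each in one orientation.
data CaterpillarArc {n m : ℕ} : Rel (CaterpillarVertex n m) 0ℓ where
  path    : ∀ {i j} → suc (toℕ i) ≡ toℕ j → CaterpillarArc (main i) (main j)
  pendant : ∀ {i k} → CaterpillarArc (main i) (leaf i k)

module _ {n m : ℕ} where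

  arc? : Decidable (CaterpillarArc {n} {m})
  arc? (main i) (main j) =
    map′ path (λ { (path eq) → eq }) (suc (toℕ i) ≟ℕ toℕ j)
  arc? (main i) (leaf j k) =
    map′ (λ { refl → pendant }) (λ { pendant → refl }) (i ≟ j)
  arc? (leaf _ _) _ = no λ ()

  caterpillarAdj? : Decidable (SymClosure (CaterpillarArc {n} {m}))
  caterpillarAdj? u v with arc? u v | arc? v u
  ... | yes p | _     = yes (fwd p)
  ... | no _  | yes q = yes (bwd q)
  ... | no ¬p | no ¬q = no λ { (fwd p) → ¬p p ; (bwd q) → ¬q q }

  caterpillarIrrefl : Irreflexive _≡_ (SymClosure (CaterpillarArc {n} {m}))
  caterpillarIrrefl refl (fwd (path eq)) = 1+n≢n eq
  caterpillarIrrefl refl (bwd (path eq)) = 1+n≢n eq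

caterpillarVertices : ∀ n m → List (CaterpillarVertex n m)
caterpillarVertices n m =
  map main (allFin n) ++ cartesianProductWith leaf (allFin n) (allFin m)

caterpillarUnique : ∀ n m → Unique (caterpillarVertices n m)
caterpillarUnique n m =
  ++⁺ (map⁺ (λ { refl → refl }) (allFin⁺ n))
      (cartesianProductWith⁺ leaf (λ { refl → refl , refl }) (allFin⁺ n) (allFin⁺ m))
      disjoint
  where
  disjoint : Disjoint (map main (allFin n))
                      (cartesianProductWith leaf (allFin n) (allFin m))
  disjoint (p , q)
    with ∈-map⁻ main p | ∈-cartesianProductWith⁻ leaf (allFin n) (allFin m) q
  ... | _ , _ , refl | _ , _ , _ , _ , ()

caterpillarComplete : ∀ n m v → v ∈ caterpillarVertices n m
caterpillarComplete n m (main i)   = ∈-++⁺ˡ (∈-map⁺ main (∈-allFin i))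
caterpillarComplete n m (leaf i k) =
  ∈-++⁺ʳ (map main (allFin n)) (∈-cartesianProductWith⁺ leaf (∈-allFin i) (∈-allFin k))

C : ℕ → ℕ → Graph
C n m = record
  { Vertex   = CaterpillarVertex n m
  ; vertices = caterpillarVertices n m
  ; unique   = caterpillarUnique n m
  ; complete = caterpillarComplete n m
  ; Adj      = SymClosure CaterpillarArc
  ; sym      = Sym.symmetric CaterpillarArc
  ; irrefl   = caterpillarIrrefl
  ; adj?     = caterpillarAdj?
  }

{-# OPTIONS --safe #-}
-- Listing the main vertices in path order and then the leaves, no arc points
-- backwards, so the edge list of C(n,m) is a permutation of the arc list.  The
-- two ends of the path have degree m + 1, the inner main vertices m + 2, the
-- leaves 1: only the first and the last path edge contribute (1 each), and each
-- leaf contributes the degree of its main vertex minus 1.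
module Submission where

open import Data.Nat using (ℕ; zero; suc; _+_; _≤_; _*_; _∸_; ∣_-_∣; z≤n; s≤s)
open import Data.Nat.ListAction using (sum)
open import Data.Nat.ListAction.Properties using (sum-++; sum-↭)
open import Data.Nat.Properties
  using (+-assoc; +-identityʳ; ≤-reflexive; <-asym; <⇒≢; m≢1+n+m; m+n∸m≡n; suc-injective;
         ∣-∣-comm; ∣-∣-identityʳ; ∣n-n∣≡0)
open import Data.Nat.Tactic.RingSolver using (solve-∀)
open import Data.Fin using (Fin; zero; suc; toℕ; fromℕ; inject₁)
open import Data.Fin.Properties using (toℕ-injective; toℕ-inject₁; toℕ-fromℕ; toℕ<n)
open import Data.List
  using (List; []; _∷_; [_]; _++_; map; length; allFin; tabulate; cartesianProductWith)
open import Data.List.Properties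
  using (length-++; length-map; length-tabulate; map-++; map-tabulate; map-∘)
open import Data.List.Membership.Propositional using (_∈_)
open import Data.List.Membership.Propositional.Properties
  using (∈-++⁺ˡ; ∈-++⁺ʳ; ∈-++⁻; ∈-map⁺; ∈-map⁻; ∈-filter⁺; ∈-filter⁻; ∈-allFin;
         ∈-cartesianProductWith⁺; ∈-cartesianProductWith⁻)
open import Data.List.Membership.Propositional.Properties.WithK using (unique∧set⇒bag)
open import Data.List.Relation.Binary.BagAndSetEquality using (∼bag⇒↭)
open import Data.List.Relation.Binary.Permutation.Propositional using (_↭_)
import Data.List.Relation.Binary.Permutation.Propositional.Properties as ↭
open import Data.List.Relation.Unary.All as All using (All; []; _∷_)
open import Data.List.Relation.Unary.AllPairs using (AllPairs; []; _∷_)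
import Data.List.Relation.Unary.AllPairs.Properties as AllPairs
open import Data.List.Relation.Unary.Any using (here; there)
open import Data.List.Relation.Unary.Unique.Propositional using (Unique)
import Data.List.Relation.Unary.Unique.Propositional.Properties as Unique
open import Data.Product using (_×_; _,_; proj₂; uncurry)
open import Data.Product.Properties using (,-injectiveʳ)
open import Data.Sum using (_⊎_; inj₁; inj₂)
open import Function using (_∘_; id)
open import Function.Bundles using (_⇔_; mk⇔; Equivalence)
open import Level using (0ℓ)
open import Relation.Binary.Core using (Rel; _⇒_)
open import Relation.Binary.Construct.Closure.Symmetric using (fwd; bwd)
open import Relation.Binary.PropositionalEquality
  using (_≡_; _≢_; refl; sym; trans; cong; cong₂; module ≡-Reasoning)
open import Relation.Nullary using (¬_; contradiction)
open import Defs
  using (C; irr; Graph; degree; edges; edgesWithin; CaterpillarVertex; main; leaf;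
         CaterpillarArc; path; pendant; caterpillarVertices)

-- Repetition-free lists and finite sums.

private
  variable
    A B D : Set
    xs ys : List A
    m n : ℕ

-- In a repetition-free list each membership has at most one proof, so a logical equivalence of
-- memberships is already a bijection. Degrees and the edge list are both found this way: guess an
-- explicit list and compare members.
unique∧set⇒↭ : Unique xs → Unique ys → (∀ {x} → x ∈ xs ⇔ x ∈ ys) → xs ↭ ys
unique∧set⇒↭ xs! ys! xs≈ys = ∼bag⇒↭ (unique∧set⇒bag xs! ys! xs≈ys)

All⇒AllPairsʳ : {R : Rel A 0ℓ} → All (λ y → ∀ x → R x y) xs → AllPairs R xs
All⇒AllPairsʳ []       = []
All⇒AllPairsʳ (_ ∷ ps) = All.map (λ r → r _) ps ∷ All⇒AllPairsʳ ps

sum-map-const : ∀ (w : A → ℕ) c → (∀ x → w x ≡ c) → ∀ xs → sum (map w xs) ≡ length xs * c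
sum-map-const w c w≡c []       = refl
sum-map-const w c w≡c (x ∷ xs) = cong₂ _+_ (w≡c x) (sum-map-const w c w≡c xs)

sum-map-cartesianProductWith : ∀ (w : D → ℕ) (f : A → B → D) (h : A → ℕ) →
  (∀ x y → w (f x y) ≡ h x) → ∀ xs ys →
  sum (map w (cartesianProductWith f xs ys)) ≡ sum (map (λ x → length ys * h x) xs)
sum-map-cartesianProductWith w f h w≡h []       ys = refl
sum-map-cartesianProductWith w f h w≡h (x ∷ xs) ys = begin
  sum (map w (map (f x) ys ++ zs))               ≡⟨ cong sum (map-++ w (map (f x) ys) zs) ⟩
  sum (map w (map (f x) ys) ++ map w zs)         ≡⟨ sum-++ (map w (map (f x) ys)) (map w zs) ⟩
  sum (map w (map (f x) ys)) + sum (map w zs)    ≡⟨ cong (λ l → sum l + sum (map w zs)) (map-∘ ys) ⟨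
  sum (map (w ∘ f x) ys) + sum (map w zs)
    ≡⟨ cong₂ _+_ (sum-map-const (w ∘ f x) (h x) (w≡h x) ys)
                 (sum-map-cartesianProductWith w f h w≡h xs ys) ⟩
  length ys * h x + sum (map (λ x → length ys * h x) xs) ∎
  where
  open ≡-Reasoning
  zs = cartesianProductWith f xs ys

sum-tabulate-init-last : ∀ n (f : Fin (suc n) → ℕ) →
  sum (tabulate f) ≡ sum (tabulate (f ∘ inject₁)) + f (fromℕ n)
sum-tabulate-init-last zero    f = +-identityʳ (f zero)
sum-tabulate-init-last (suc n) f =
  trans (cong (f zero +_) (sum-tabulate-init-last n (f ∘ suc)))
        (sym (+-assoc (f zero) _ _))

-- Serves the sum over path edges and the sum over main vertices, each constant except at its two
-- ends. The ends must be distinct; for path edges this requires at least three main vertices, which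
-- is where the bound on `n` comes from.
sum-allFin-ends : ∀ n (f : Fin (2 + n) → ℕ) c → (∀ j → f (suc (inject₁ j)) ≡ c) →
  sum (map f (allFin (2 + n))) ≡ f zero + (n * c + f (fromℕ (suc n)))
sum-allFin-ends n f c f≡c = cong (f zero +_) (begin
  sum (map f (tabulate suc))               ≡⟨ cong sum (map-tabulate suc f) ⟩
  sum (tabulate (f ∘ suc))                 ≡⟨ sum-tabulate-init-last n (f ∘ suc) ⟩
  sum (tabulate inner) + last              ≡⟨ cong (λ l → sum l + last) (map-tabulate id inner) ⟨
  sum (map inner (allFin n)) + last        ≡⟨ cong (_+ last) (sum-map-const inner c f≡c (allFin n)) ⟩
  length (allFin n) * c + last             ≡⟨ cong (λ l → l * c + last) (length-tabulate {n = n} id) ⟩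
  n * c + last                             ∎)
  where
  open ≡-Reasoning
  inner = f ∘ suc ∘ inject₁
  last  = f (fromℕ (suc n))

-- Degrees and edge lists of a graph with an orientation.

module _ (G : Graph) where
  open Graph G using (Vertex; vertices; Adj; adj?; irrefl)

  degree≡length : ∀ {v ns} → Unique ns → (∀ {u} → Adj v u ⇔ u ∈ ns) → degree G v ≡ length ns
  degree≡length {v} ns! adj⇔∈ = ↭.↭-length (unique∧set⇒↭
    (Unique.filter⁺ (adj? v) (Graph.unique G)) ns!
    (mk⇔ (Equivalence.to adj⇔∈ ∘ proj₂ ∘ ∈-filter⁻ (adj? v) {xs = vertices})
         (λ u∈ns → ∈-filter⁺ (adj? v) {xs = vertices} (Graph.complete G _) (Equivalence.from adj⇔∈ u∈ns))))

  ∈-edgesWithin⇒∈ˡ : ∀ {u v} vs → (u , v) ∈ edgesWithin G vs → u ∈ vs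
  ∈-edgesWithin⇒∈ˡ (x ∷ vs) p with ∈-++⁻ (map (x ,_) _) p
  ... | inj₂ q = there (∈-edgesWithin⇒∈ˡ vs q)
  ... | inj₁ q with _ , _ , refl ← ∈-map⁻ (x ,_) q = here refl

  -- Every pair produced for the head `x` has first component `x`, while the later pairs start at
  -- vertices of the tail, where `x` does not recur.
  edgesWithin-unique : ∀ {vs} → Unique vs → Unique (edgesWithin G vs)
  edgesWithin-unique []                     = []
  edgesWithin-unique {x ∷ vs} (x∉vs ∷ vs!) =
    Unique.++⁺ (Unique.map⁺ ,-injectiveʳ (Unique.filter⁺ (adj? x) vs!))
               (edgesWithin-unique vs!) disjoint
    where
    disjoint : ∀ {e} → ¬ (e ∈ map (x ,_) _ × e ∈ edgesWithin G vs)
    disjoint (p , q) with _ , _ , refl ← ∈-map⁻ (x ,_) p =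
      All.lookup x∉vs (∈-edgesWithin⇒∈ˡ vs q) refl

  module _ {Arc : Rel Vertex 0ℓ} (arc⇒adj : Arc ⇒ Adj)
           (orient : ∀ {u v} → Adj u v → Arc u v ⊎ Arc v u) where

    -- The list is a topological order for `Arc`. As `edgesWithin` records each edge from the
    -- earlier to the later vertex, the recorded direction is then that of the arc.
    NoBackArc : List Vertex → Set
    NoBackArc = AllPairs (λ u v → ¬ Arc v u)

    ∈-edgesWithin⁻ : ∀ {u v vs} → NoBackArc vs → (u , v) ∈ edgesWithin G vs → Arc u v
    ∈-edgesWithin⁻ {vs = x ∷ vs} (nx ∷ nvs) p with ∈-++⁻ (map (x ,_) _) p
    ... | inj₂ q = ∈-edgesWithin⁻ nvs q
    ... | inj₁ q with _ , r , refl ← ∈-map⁻ (x ,_) q with ∈-filter⁻ (adj? x) r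
    ...   | v∈vs , xv with orient xv
    ...     | inj₁ a = a
    -- Here `v` comes after `x` in the list, so an arc from `v` to `x` would point backwards.
    ...     | inj₂ a = contradiction a (All.lookup nx v∈vs)

    ∈-edgesWithin⁺ : ∀ {u v vs} → NoBackArc vs → u ∈ vs → v ∈ vs → Arc u v →
                     (u , v) ∈ edgesWithin G vs
    -- Both ends at the head would be a loop; in the next clause the arc would run back to the head.
    ∈-edgesWithin⁺ _          (here refl) (here refl) a = contradiction (arc⇒adj a) (irrefl refl)
    ∈-edgesWithin⁺ (nx ∷ _)   (there u∈)  (here refl) a = contradiction a (All.lookup nx u∈)
    ∈-edgesWithin⁺ _          (here refl) (there v∈)  a =
      ∈-++⁺ˡ (∈-map⁺ _ (∈-filter⁺ (adj? _) v∈ (arc⇒adj a)))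
    ∈-edgesWithin⁺ (_ ∷ nvs)  (there u∈)  (there v∈)  a =
      ∈-++⁺ʳ (map _ _) (∈-edgesWithin⁺ nvs u∈ v∈ a)

    edges↭arcs : ∀ {as} → NoBackArc vertices → Unique as →
                 (∀ {u v} → Arc u v ⇔ (u , v) ∈ as) → edges G ↭ as
    edges↭arcs nvs as! arc⇔∈ = unique∧set⇒↭ (edgesWithin-unique (Graph.unique G)) as!
      (mk⇔ (Equivalence.to arc⇔∈ ∘ ∈-edgesWithin⁻ nvs)
           (∈-edgesWithin⁺ nvs (Graph.complete G _) (Graph.complete G _) ∘ Equivalence.from arc⇔∈))

-- The arcs of the caterpillar.

suc-toℕ⇒inject₁ : ∀ {i : Fin (suc n)} {j} → suc (toℕ i) ≡ toℕ (suc j) → i ≡ inject₁ j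
suc-toℕ⇒inject₁ {j = j} eq = toℕ-injective (trans (suc-injective eq) (sym (toℕ-inject₁ j)))

-- Among main vertices an arc raises the position by one, so it cannot go back. Leaves are sinks,
-- which settles both the leaf-leaf pairs and the main-leaf pairs.
caterpillarNoBackArc : ∀ n m → AllPairs (λ u v → ¬ CaterpillarArc v u) (caterpillarVertices n m)
caterpillarNoBackArc n m = AllPairs.++⁺
  (AllPairs.map⁺ (AllPairs.tabulate⁺-< λ { i<j (path eq) → <-asym i<j (≤-reflexive eq) }))
  (All⇒AllPairsʳ leaves-sinks)
  (All.tabulate λ _ → All.map (λ sink → sink _) leaves-sinks)
  where
  leaves-sinks : All (λ v → ∀ u → ¬ CaterpillarArc v u)
                     (cartesianProductWith leaf (allFin n) (allFin m))
  leaves-sinks = All.tabulate leaf-sink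
    where
    leaf-sink : ∀ {v} → v ∈ cartesianProductWith leaf (allFin n) (allFin m) →
                ∀ u → ¬ CaterpillarArc v u
    leaf-sink v∈ u a with _ , _ , _ , _ , refl ← ∈-cartesianProductWith⁻ leaf (allFin n) (allFin m) v∈
      with () ← a

Edge : ℕ → ℕ → Set
Edge n m = CaterpillarVertex n m × CaterpillarVertex n m

pathEdge : Fin n → Edge (suc n) m
pathEdge l = main (inject₁ l) , main (suc l)

leafEdge : Fin n → Fin m → Edge n m
leafEdge i k = main i , leaf i k

-- The parameter `n` counts path edges, one fewer than the main vertices.
caterpillarArcs : ∀ n m → List (Edge (suc n) m)
caterpillarArcs n m =
  map pathEdge (allFin n) ++ cartesianProductWith leafEdge (allFin (suc n)) (allFin m)

caterpillarArcs-unique : ∀ n m → Unique (caterpillarArcs n m)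
caterpillarArcs-unique n m = Unique.++⁺
  (Unique.map⁺ (λ { refl → refl }) (Unique.allFin⁺ n))
  (Unique.cartesianProductWith⁺ leafEdge (λ { refl → refl , refl })
    (Unique.allFin⁺ (suc n)) (Unique.allFin⁺ m))
  disjoint
  where
  disjoint : ∀ {e} → ¬ (e ∈ map pathEdge (allFin n) ×
                        e ∈ cartesianProductWith leafEdge (allFin (suc n)) (allFin m))
  disjoint (p , q)
    -- The second component would be both a main vertex and a leaf.
    with ∈-map⁻ pathEdge p | ∈-cartesianProductWith⁻ leafEdge (allFin (suc n)) (allFin m) q
  ... | _ , _ , refl | _ , _ , _ , _ , ()

arc⇔∈caterpillarArcs : ∀ {u v : CaterpillarVertex (suc n) m} →
  CaterpillarArc u v ⇔ (u , v) ∈ caterpillarArcs n m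
arc⇔∈caterpillarArcs {n} {m} = mk⇔ to from
  where
  to : ∀ {u v} → CaterpillarArc u v → (u , v) ∈ caterpillarArcs n m
  -- No arc enters `main zero`, and the predecessor of `suc j` is `inject₁ j`, so the arc is
  -- `pathEdge j`.
  to (path {j = suc j} eq) with refl ← suc-toℕ⇒inject₁ eq =
    ∈-++⁺ˡ (∈-map⁺ pathEdge (∈-allFin j))
  to (pendant {i} {k}) =
    ∈-++⁺ʳ (map pathEdge (allFin n)) (∈-cartesianProductWith⁺ leafEdge (∈-allFin i) (∈-allFin k))

  from : ∀ {u v} → (u , v) ∈ caterpillarArcs n m → CaterpillarArc u v
  from e∈ with ∈-++⁻ (map pathEdge (allFin n)) e∈
  ... | inj₁ p with l , _ , refl ← ∈-map⁻ pathEdge p = path (cong suc (toℕ-inject₁ l))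
  ... | inj₂ q
    with _ , _ , _ , _ , refl ← ∈-cartesianProductWith⁻ leafEdge (allFin (suc n)) (allFin m) q =
    pendant

edges-caterpillar : ∀ n m → edges (C (suc n) m) ↭ caterpillarArcs n m
edges-caterpillar n m = edges↭arcs (C (suc n) m) fwd
  (λ { (fwd a) → inj₁ a ; (bwd a) → inj₂ a })
  (caterpillarNoBackArc (suc n) m) (caterpillarArcs-unique n m) arc⇔∈caterpillarArcs

-- Degrees in the caterpillar.

PathAdj : Rel (Fin n) 0ℓ
PathAdj i j = suc (toℕ i) ≡ toℕ j ⊎ suc (toℕ j) ≡ toℕ i

-- The `m` leaves at `main i` are counted once and for all here, so that each position on the path
-- only needs its list `ps` of path neighbours.
degree-main : ∀ {i : Fin n} {ps} → Unique ps → (∀ {j} → PathAdj i j ⇔ j ∈ ps) →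
  degree (C n m) (main i) ≡ length ps + m
degree-main {n} {m} {i} {ps} ps! adj⇔∈ = begin
  degree (C n m) (main i)                          ≡⟨ degree≡length (C n m) ns! (mk⇔ to from) ⟩
  length ns                                        ≡⟨ length-++ (map main ps) ⟩
  length (map main ps) + length (map (leaf i) (allFin m))
    ≡⟨ cong₂ _+_ (length-map main ps) (length-map (leaf i) (allFin m)) ⟩
  length ps + length (allFin m)                    ≡⟨ cong (length ps +_) (length-tabulate id) ⟩
  length ps + m                                    ∎
  where
  open ≡-Reasoning

  ns : List (CaterpillarVertex n m)
  ns = map main ps ++ map (leaf i) (allFin m)

  disjoint : ∀ {v} → ¬ (v ∈ map main ps × v ∈ map (leaf i) (allFin m))
  disjoint (p , q) with ∈-map⁻ main p | ∈-map⁻ (leaf i) q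
  ... | _ , _ , refl | _ , _ , ()

  ns! : Unique ns
  ns! = Unique.++⁺ (Unique.map⁺ (λ { refl → refl }) ps!)
                   (Unique.map⁺ (λ { refl → refl }) (Unique.allFin⁺ m)) disjoint

  to : ∀ {v} → Graph.Adj (C n m) (main i) v → v ∈ ns
  to (fwd (path eq))         = ∈-++⁺ˡ (∈-map⁺ main (Equivalence.to adj⇔∈ (inj₁ eq)))
  to (bwd (path eq))         = ∈-++⁺ˡ (∈-map⁺ main (Equivalence.to adj⇔∈ (inj₂ eq)))
  to (fwd (pendant {k = k})) = ∈-++⁺ʳ (map main ps) (∈-map⁺ (leaf i) (∈-allFin k))

  from : ∀ {v} → v ∈ ns → Graph.Adj (C n m) (main i) v
  from v∈ with ∈-++⁻ (map main ps) v∈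
  ... | inj₂ q with _ , _ , refl ← ∈-map⁻ (leaf i) q = fwd pendant
  ... | inj₁ p with _ , j∈ , refl ← ∈-map⁻ main p with Equivalence.from adj⇔∈ j∈
  ...   | inj₁ eq = fwd (path eq)
  ...   | inj₂ eq = bwd (path eq)

degree-leaf : ∀ n m i k → degree (C n m) (leaf i k) ≡ 1
-- The neighbour list, left to inference, is the singleton of `main i`.
degree-leaf n m i k = degree≡length (C n m) ([] ∷ [])
  (mk⇔ (λ { (bwd pendant) → here refl }) (λ { (here refl) → bwd pendant }))

degree-first : ∀ n m → degree (C (2 + n) m) (main zero) ≡ 1 + m
degree-first n m = degree-main {n = 2 + n} {ps = [ suc zero ]} ([] ∷ []) (mk⇔
  (λ { (inj₁ eq) → here (sym (toℕ-injective eq)) ; (inj₂ ()) })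
  (λ { (here refl) → inj₁ refl }))

-- The form `suc (inject₁ j)` reaches exactly the positions other than the two ends, as in
-- `sum-allFin-ends`. The neighbours sit at positions `toℕ j` and `2 + toℕ j`.
degree-inner : ∀ n m (j : Fin n) → degree (C (2 + n) m) (main (suc (inject₁ j))) ≡ 2 + m
degree-inner n m j = degree-main {n = 2 + n} {ps = inject₁ (inject₁ j) ∷ suc (suc j) ∷ []}
  ((before≢after ∷ []) ∷ [] ∷ []) (mk⇔ to from)
  where
  toℕ-before : toℕ (inject₁ (inject₁ j)) ≡ toℕ j
  toℕ-before = trans (toℕ-inject₁ (inject₁ j)) (toℕ-inject₁ j)

  before≢after : inject₁ (inject₁ j) ≢ suc (suc j)
  before≢after eq = m≢1+n+m (toℕ j) {1} (trans (sym toℕ-before) (cong toℕ eq))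

  to : ∀ {i} → PathAdj (suc (inject₁ j)) i → i ∈ inject₁ (inject₁ j) ∷ suc (suc j) ∷ []
  to (inj₁ eq) = there (here (toℕ-injective (trans (sym eq) (cong (2 +_) (toℕ-inject₁ j)))))
  to (inj₂ eq) = here (suc-toℕ⇒inject₁ eq)

  from : ∀ {i} → i ∈ inject₁ (inject₁ j) ∷ suc (suc j) ∷ [] → PathAdj (suc (inject₁ j)) i
  from (here refl)         = inj₂ (cong suc (toℕ-inject₁ (inject₁ j)))
  from (there (here refl)) = inj₁ (cong (2 +_) (toℕ-inject₁ j))

degree-last : ∀ n m → degree (C (2 + n) m) (main (fromℕ (suc n))) ≡ 1 + m
degree-last n m = degree-main {n = 2 + n} {ps = [ inject₁ (fromℕ n) ]} ([] ∷ []) (mk⇔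
  -- A successor of the last vertex would have position `2 + n`, outside `Fin (2 + n)`.
  (λ { (inj₁ eq) → contradiction (trans (sym eq) (cong (2 +_) (toℕ-fromℕ n))) (<⇒≢ (toℕ<n _))
     ; (inj₂ eq) → here (suc-toℕ⇒inject₁ eq) })
  (λ { (here refl) → inj₂ (cong suc (toℕ-inject₁ (fromℕ n))) }))

-- Summing the degree differences.

irregularity : (A → ℕ) → A × A → ℕ
irregularity d = uncurry λ u v → ∣ d u - d v ∣

-- The degrees enter only as an abstract labelling d: with the actual degree
-- function, unification would unfold the neighbour lists.
module _ {k m : ℕ} (d : CaterpillarVertex (3 + k) m → ℕ)
         (first  : d (main zero) ≡ 1 + m)
         (inner  : ∀ j → d (main (suc (inject₁ j))) ≡ 2 + m)
         (last   : d (main (fromℕ (2 + k))) ≡ 1 + m)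
         (leaf≡1 : ∀ i j → d (leaf i j) ≡ 1) where
  open ≡-Reasoning

  private
    w : Edge (3 + k) m → ℕ
    w = irregularity d

    pathEdges leafEdges : List (Edge (3 + k) m)
    pathEdges = map pathEdge (allFin (2 + k))
    leafEdges = cartesianProductWith leafEdge (allFin (3 + k)) (allFin m)

    w≡ : ∀ {u v a b} → d u ≡ a → d v ≡ b → w (u , v) ≡ ∣ a - b ∣
    w≡ = cong₂ ∣_-_∣

    ∣m-1+m∣≡1 : ∀ m → ∣ m - suc m ∣ ≡ 1
    ∣m-1+m∣≡1 zero    = refl
    ∣m-1+m∣≡1 (suc m) = ∣m-1+m∣≡1 m

    sum-paths : sum (map w pathEdges) ≡ 1 + (k * 0 + 1)
    sum-paths = begin
      sum (map w pathEdges)                           ≡⟨ cong sum (map-∘ {g = w} {f = pathEdge} (allFin (2 + k))) ⟨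
      sum (map (w ∘ pathEdge) (allFin (2 + k)))
        ≡⟨ sum-allFin-ends k (w ∘ pathEdge) 0 (λ j →
             -- Path edge `suc (inject₁ j)` joins two inner vertices, both of degree `2 + m`, hence
             -- the constant 0.
             trans (w≡ (inner (inject₁ j)) (inner (suc j)))
                   (∣n-n∣≡0 (2 + m))) ⟩
      w (pathEdge zero) + (k * 0 + w (pathEdge (fromℕ (suc k))))
        ≡⟨ cong₂ (λ a b → a + (k * 0 + b))
             -- The two outer path edges join degrees `1 + m` and `2 + m`. An inner vertex exists
             -- because there are `3 + k` main vertices.
             (trans (w≡ first (inner zero)) (∣m-1+m∣≡1 (1 + m)))
             (trans (w≡ (inner (fromℕ k)) last)
                    (trans (∣-∣-comm (2 + m) (1 + m)) (∣m-1+m∣≡1 (1 + m)))) ⟩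
      1 + (k * 0 + 1) ∎

    excess : Fin (3 + k) → ℕ
    excess i = ∣ d (main i) - 1 ∣

    m*excess≡ : ∀ {i a} → d (main i) ≡ suc a → m * excess i ≡ m * a
    m*excess≡ {a = a} eq = cong (m *_) (trans (cong ∣_- 1 ∣ eq) (∣-∣-identityʳ a))

    -- A leaf has degree 1, so each of the `m` leaves at `main i` contributes `excess i`: this is
    -- `m` at the two ends and `1 + m` at the `1 + k` inner vertices.
    sum-leaves : sum (map w leafEdges) ≡ m * m + ((1 + k) * (m * (1 + m)) + m * m)
    sum-leaves = begin
      sum (map w leafEdges)
        ≡⟨ sum-map-cartesianProductWith w leafEdge excess
             (λ i j → w≡ {main i} refl (leaf≡1 i j))
             (allFin (3 + k)) (allFin m) ⟩
      sum (map (λ i → length (allFin m) * excess i) (allFin (3 + k)))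
        ≡⟨ cong (λ l → sum (map (λ i → l * excess i) (allFin (3 + k)))) (length-tabulate {n = m} id) ⟩
      sum (map (λ i → m * excess i) (allFin (3 + k)))
        ≡⟨ sum-allFin-ends (suc k) (λ i → m * excess i) (m * (1 + m)) (λ j → m*excess≡ (inner j)) ⟩
      m * excess zero + ((1 + k) * (m * (1 + m)) + m * excess (fromℕ (2 + k)))
        ≡⟨ cong₂ (λ a b → a + ((1 + k) * (m * (1 + m)) + b))
             (m*excess≡ first) (m*excess≡ last) ⟩
      m * m + ((1 + k) * (m * (1 + m)) + m * m) ∎

    collect : ∀ k m → (1 + (k * 0 + 1)) + (m * m + ((1 + k) * (m * (1 + m)) + m * m))
                    ≡ 2 + (2 * (m * m) + (1 + k) * (m * (1 + m)))
    collect = solve-∀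

  sum-irregularity-caterpillarArcs :
    sum (map w (caterpillarArcs (2 + k) m)) ≡ 2 + (2 * (m * m) + (1 + k) * (m * (1 + m)))
  sum-irregularity-caterpillarArcs = begin
    sum (map w (caterpillarArcs (2 + k) m))        ≡⟨ cong sum (map-++ w pathEdges leafEdges) ⟩
    sum (map w pathEdges ++ map w leafEdges)       ≡⟨ sum-++ (map w pathEdges) (map w leafEdges) ⟩
    sum (map w pathEdges) + sum (map w leafEdges)  ≡⟨ cong₂ _+_ sum-paths sum-leaves ⟩
    (1 + (k * 0 + 1)) + (m * m + ((1 + k) * (m * (1 + m)) + m * m))
                                                   ≡⟨ collect k m ⟩
    2 + (2 * (m * m) + (1 + k) * (m * (1 + m)))    ∎

-- A sum does not change when its terms are permuted, so the arc list may replace the edge list. In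
-- terms of the number n = 3 + k of main vertices, the value is 2 + 2m² + (n - 2)m(m + 1).
irr-caterpillar : ∀ k m → irr (C (3 + k) m) ≡ 2 + (2 * (m * m) + (1 + k) * (m * (1 + m)))
irr-caterpillar k m = trans
  (sum-↭ (↭.map⁺ (irregularity (degree (C (3 + k) m))) (edges-caterpillar (2 + k) m)))
  (sum-irregularity-caterpillarArcs (degree (C (3 + k) m))
    (degree-first (suc k) m) (degree-inner (suc k) m) (degree-last (suc k) m) (degree-leaf (3 + k) m))

proposition3p1 : ∀ (n : ℕ) → 3 ≤ n → irr (C n 3) ≡ 12 * n ∸ 4
proposition3p1 (suc (suc (suc k))) (s≤s (s≤s (s≤s z≤n))) = begin
  irr (C (3 + k) 3)    ≡⟨ irr-caterpillar k 3 ⟩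
  -- At `m = 3` the closed form evaluates to this: 20 = 2 + 2 * 9 and 12 = 3 * 4. Adding 4 first
  -- turns the truncated subtraction into an exact one.
  20 + (1 + k) * 12    ≡⟨ m+n∸m≡n 4 (20 + (1 + k) * 12) ⟨
  4 + (20 + (1 + k) * 12) ∸ 4 ≡⟨ cong (_∸ 4) (collect k) ⟩
  12 * (3 + k) ∸ 4     ∎
  where
  open ≡-Reasoning
  collect : ∀ k → 4 + (20 + (1 + k) * 12) ≡ 12 * (3 + k)
  collect = solve-∀
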